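{- The logic $\mathrm{LTL}[\mathsf{F}]$ can be exponentially more succinct than $\mathsf{F}(\mathrm{LTL}[\mathsf{Y},\mathsf{wY},\mathsf{O},\mathsf{H}])$ (over finite traces). That is, there exist finite sets of atomic propositions $AP_n$ and languages $\mathcal{L}_n\subseteq(2^{AP_n})^+$, $n\ge 1$, such that for every $n\ge1$: (i) there is $\phi\in\mathrm{LTL}[\mathsf{F}]$ with $\mathcal{L}(\phi)=\mathcal{L}_n$ and $\mathrm{size}(\phi)$ bounded by a polynomial in $n$; and (ii) every $\psi\in\mathsf{F}(\mathrm{LTL}[\mathsf{Y},\mathsf{wY},\mathsf{O},\mathsf{H}])$ with $\mathcal{L}(\psi)=\mathcal{L}_n$ has $\mathrm{size}(\psi)\in 2^{\Omega(n)}$.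
   Context: Let $AP$ be a finite set of atomic propositions and $\Sigma=2^{AP}$. Formulae (in negation normal form) are generated by $\phi ::= p \mid \neg p \mid \phi\lor\phi\mid\phi\land\phi\mid \mathsf{X}\phi\mid\mathsf{wX}\phi\mid\mathsf{F}\phi\mid\mathsf{G}\phi\mid\mathsf{Y}\phi\mid\mathsf{wY}\phi\mid\mathsf{O}\phi\mid\mathsf{H}\phi$ with $p\in AP$. For a finite non-empty trace $\sigma=w_0\cdots w_m\in\Sigma^+$ ($|\sigma|=m+1$, $\sigma[i]=w_i$) and $0\le i<|\sigma|$: $\sigma,i\models p$ iff $p\in\sigma[i]$; $\sigma,i\models\neg p$ iff $p\notin\sigma[i]$; $\lor,\land$ as usual; $\sigma,i\models\mathsf{X}\phi$ iff $i+1<|\sigma|$ and $\sigma,i+1\models\phi$; $\sigma,i\models\mathsf{wX}\phi$ iff $i+1=|\sigma|$ or $\sigma,i+1\models\phi$; $\sigma,i\models\mathsf{F}\phi$ iff $\sigma,j\models\phi$ for some $i\le j<|\sigma|$; $\sigma,i\models\mathsf{G}\phi$ iff $\sigma,j\models\phi$ for all $i\le j<|\sigma|$; $\sigma,i\models\mathsf{Y}\phi$ iff $i>0$ and $\sigma,i-1\models\phi$; $\sigma,i\models\mathsf{wY}\phi$ iff $i=0$ or $\sigma,i-1\models\phi$; $\sigma,i\models\mathsf{O}\phi$ iff $\sigma,j\models\phi$ for some $0\le j\le i$; $\sigma,i\models\mathsf{H}\phi$ iff $\sigma,j\models\phi$ for all $0\le j\le i$. $\sigma\models\phi$ means $\sigma,0\models\phi$;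 $\mathcal{L}(\phi)=\{\sigma\in\Sigma^+:\sigma\models\phi\}$. Size: literals have size 1, unary temporal operators add 1, $\mathrm{size}(\phi_1\circ\phi_2)=\mathrm{size}(\phi_1)+\mathrm{size}(\phi_2)+1$ for $\circ\in\{\land,\lor\}$. For a set $S$ of temporal operators, $\mathrm{LTL}[S]$ is the set of formulae whose temporal operators lie in $S$, and $\mathsf{F}(\mathrm{LTL}[S])$ is the set of formulae $\mathsf{F}(\alpha)$ with $\alpha\in\mathrm{LTL}[S]$. -}

module Defs where

open import Level using (0ℓ)
open import Data.Nat using (ℕ; suc; _+_; _*_; _^_; _≤_; _<_)
open import Data.Fin using (Fin; zero; toℕ)
open import Data.Fin.Subset using (Subset) renaming (_∈_ to _∈ₛ_; _∉_ to _∉ₛ_)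
open import Data.List using (List; foldr; lookup)
open import Data.List.NonEmpty using (List⁺; length; toList)
open import Data.Product using (Σ-syntax; ∃-syntax; _×_)
open import Data.Sum using (_⊎_)
open import Data.Unit using (⊤)
open import Relation.Binary.PropositionalEquality using (_≡_)
open import Relation.Unary using (Pred; _∈_; ｛_｝; _∪_)

-- Throughout, a finite set of k atomic propositions is represented by Fin k,
-- so that the alphabet 2^AP is Subset k.

data Op : Set where
  X wX F G Y wY O H : Op

infixr 8 _·_
infixr 7 _∧_
infixr 6 _∨_

data Formula (k : ℕ) : Set where
  atom  : Fin k → Formula k
  ¬atom : Fin k → Formula k
  _∨_   : Formula k → Formula k → Formula k
  _∧_   : Formula k → Formula k → Formula k
  _·_   : Op → Formula k → Formula k

size : ∀ {k} → Formula k → ℕ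
size (atom p)  = 1
size (¬atom p) = 1
size (φ ∨ ψ)   = size φ + size ψ + 1
size (φ ∧ ψ)   = size φ + size ψ + 1
size (o · φ)   = size φ + 1

Trace : ℕ → Set
Trace k = List⁺ (Subset k)

Position : ∀ {k} → Trace k → Set
Position σ = Fin (length σ)

_[_] : ∀ {k} (σ : Trace k) → Position σ → Subset k
σ [ i ] = lookup (toList σ) i

-- Since j ranges over positions of σ, the existence of j with
-- toℕ j ≡ suc (toℕ i) includes the requirement i + 1 < |σ|; similarly, the
-- existence of j with suc (toℕ j) ≡ toℕ i includes i > 0.
infix 4 _,_⊨_
_,_⊨_ : ∀ {k} (σ : Trace k) → Position σ → Formula k → Set
σ , i ⊨ atom p  = p ∈ₛ σ [ i ]
σ , i ⊨ ¬atom p = p ∉ₛ σ [ i ]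
σ , i ⊨ φ ∨ ψ   = (σ , i ⊨ φ) ⊎ (σ , i ⊨ ψ)
σ , i ⊨ φ ∧ ψ   = (σ , i ⊨ φ) × (σ , i ⊨ ψ)
σ , i ⊨ X · φ   = Σ[ j ∈ Position σ ] (toℕ j ≡ suc (toℕ i) × (σ , j ⊨ φ))
σ , i ⊨ wX · φ  = suc (toℕ i) ≡ length σ ⊎ Σ[ j ∈ Position σ ] (toℕ j ≡ suc (toℕ i) × (σ , j ⊨ φ))
σ , i ⊨ F · φ   = Σ[ j ∈ Position σ ] (toℕ i ≤ toℕ j × (σ , j ⊨ φ))
σ , i ⊨ G · φ   = (j : Position σ) → toℕ i ≤ toℕ j → σ , j ⊨ φ
σ , i ⊨ Y · φ   = Σ[ j ∈ Position σ ] (suc (toℕ j) ≡ toℕ i × (σ , j ⊨ φ))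
σ , i ⊨ wY · φ  = toℕ i ≡ 0 ⊎ Σ[ j ∈ Position σ ] (suc (toℕ j) ≡ toℕ i × (σ , j ⊨ φ))
σ , i ⊨ O · φ   = Σ[ j ∈ Position σ ] (toℕ j ≤ toℕ i × (σ , j ⊨ φ))
σ , i ⊨ H · φ   = (j : Position σ) → toℕ j ≤ toℕ i → σ , j ⊨ φ

Language : ℕ → Set₁
Language k = Pred (Trace k) 0ℓ

𝓛 : ∀ {k} → Formula k → Language k
𝓛 φ σ = σ , zero ⊨ φ

LTL[_] : ∀ {k} → Pred Op 0ℓ → Pred (Formula k) 0ℓ
LTL[ S ] (atom p)  = ⊤
LTL[ S ] (¬atom p) = ⊤
LTL[ S ] (φ ∨ ψ)   = LTL[ S ] φ × LTL[ S ] ψ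
LTL[ S ] (φ ∧ ψ)   = LTL[ S ] φ × LTL[ S ] ψ
LTL[ S ] (o · φ)   = o ∈ S × LTL[ S ] φ

F⟨LTL[_]⟩ : ∀ {k} → Pred Op 0ℓ → Pred (Formula k) 0ℓ
F⟨LTL[ S ]⟩ ψ = ∃[ α ] (α ∈ LTL[ S ] × ψ ≡ F · α)

OnlyF : Pred Op 0ℓ
OnlyF = ｛ F ｝

PastOps : Pred Op 0ℓ
PastOps = ｛ Y ｝ ∪ ｛ wY ｝ ∪ ｛ O ｝ ∪ ｛ H ｝

-- Coefficient list, constant term first.  Natural coefficients suffice for
-- upper bounds.
Polynomial : Set
Polynomial = List ℕ

eval : Polynomial → ℕ → ℕ
eval p n = foldr (λ a r → a + n * r) 0 p

-- g ∈ 2^Ω(n): for some rational c = a / b > 0, eventually 2^(c n) ≤ g n,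
-- with both sides raised to the power b.
2^Ω[n] : Pred (ℕ → ℕ) 0ℓ
2^Ω[n] g = ∃[ a ] ∃[ b ] ∃[ N ] (0 < a × 0 < b × (∀ n → N ≤ n → 2 ^ (a * n) ≤ g n ^ b))

{-# OPTIONS --safe #-}

-- A pure-past formula α, evaluated along a trace, behaves like a deterministic
-- automaton: the truth values of its subformulae at one position, together with
-- the next letter, determine them at the next position.  Hence α distinguishes
-- at most 2 ^ size α prefixes.  On the other hand, let Lₙ say that some "data"
-- letter agrees, bit by bit, with later "query" letters.  After a prefix listing
-- a set S of n-bit data letters, a single query B leads into Lₙ exactly when
-- B ∈ S, so the 2 ^ 2 ^ n sets S give pairwise distinguishable prefixes.
module Submission where

open import Data.Bool using (Bool; true; false; not; T; T?) renaming (_∧_ to _&&_; _∨_ to _||_)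
open import Data.Bool.Properties using (T-≡; T-not-≡; T-∧; T-∨; ⇔→≡; ¬-not)
open import Data.Fin using (Fin; zero; suc; toℕ; inject₁; combine; quotient; remainder)
open import Data.Fin.Induction using (<-weakInduction)
open import Data.Fin.Properties using (toℕ-inject₁; toℕ-injective; 2↔Bool; remQuot-combine; combine-remQuot; injective⇒≤)
open import Data.Fin.Subset using (Subset; inside; outside) renaming (_∈_ to _∈ₛ_; ⊥ to ∅)
open import Data.List using (List; []; _∷_; _∷ʳ_; _++_; map; filter; foldl; allFin; length; lookup)
open import Data.List.Membership.Propositional using () renaming (_∈_ to _∈ˡ_)
open import Data.List.Membership.Propositional.Properties using (∈-map⁺; ∈-map⁻; ∈-++⁺ˡ; ∈-++⁻; ∈-filter⁺; ∈-filter⁻; ∈-lookup; ∈-allFin)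
open import Data.List.NonEmpty using (_∷_)
open import Data.List.Properties using (++-identityʳ)
open import Data.List.Relation.Unary.Any using (here; index)
open import Data.List.Relation.Unary.Any.Properties using (lookup-index)
open import Data.Nat using (ℕ; zero; suc; _+_; _*_; _^_; _≤_; _≤?_; z≤n; s≤s)
open import Data.Nat.Properties using (≤-refl; ≤-reflexive; ≤-trans; m≤m+n; m≤n⇒m<n∨m≡n; n≤1+n; *-identityˡ; *-identityʳ; +-comm; ^-monoʳ-<; ≰⇒>; <⇒≱; suc-injective; *-zeroʳ; +-identityʳ)
open import Data.Nat.Solver using (module +-*-Solver)
open import Data.Product as Product using (Σ-syntax; ∃-syntax; _×_; _,_; proj₁; proj₂)
open import Data.Sum as Sum using (_⊎_; inj₁; inj₂)
open import Data.Unit using (tt)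
open import Data.Vec using (Vec; []; _∷_; here) renaming (_++_ to _++ᵥ_; [_] to [_]ᵥ; lookup to lookupᵥ)
open import Data.Vec.Properties using (++-injective; ∷-injectiveˡ; []=⇒lookup; lookup⇒[]=; tabulate∘lookup; tabulate-cong)
open import Function using (_∘_; id)
open import Function.Bundles using (_⇔_; mk⇔; Equivalence; Inverse)
open import Function.Definitions using (Injective)
open import Relation.Binary.PropositionalEquality using (_≡_; refl; sym; trans; cong; cong₂; subst)
open import Relation.Nullary using (Dec; yes; no; ¬_; contradiction)
open import Relation.Unary using (_∈_; _≐_)
open import Defs

open Equivalence using (to; from)

private
  variable
    k n : ℕ

-- Pure-past formulae on prefixes.

infixl 5 _▷_

-- Non-empty, with the newest letter outermost, so that past operators are evaluated by structural
-- recursion.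
data Prefix (k : ℕ) : Set where
  start : Subset k → Prefix k
  _▷_   : Prefix k → Subset k → Prefix k

last : Prefix k → Subset k
last (start a) = a
last (u ▷ a)   = a

-- Only meaningful on pure-past formulae; future operators get the junk value false.
holds : Formula k → Prefix k → Bool
holds (atom p)  u         = lookupᵥ (last u) p
holds (¬atom p) u         = not (lookupᵥ (last u) p)
holds (φ ∨ ψ)   u         = holds φ u || holds ψ u
holds (φ ∧ ψ)   u         = holds φ u && holds ψ u
holds (Y · φ)   (start a) = false
holds (Y · φ)   (u ▷ a)   = holds φ u
holds (wY · φ)  (start a) = true
holds (wY · φ)  (u ▷ a)   = holds φ u
holds (O · φ)   (start a) = holds φ (start a)
holds (O · φ)   (u ▷ a)   = holds φ (u ▷ a) || holds (O · φ) u
holds (H · φ)   (start a) = holds φ (start a)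
holds (H · φ)   (u ▷ a)   = holds φ (u ▷ a) && holds (H · φ) u
holds (X · φ)   u         = false
holds (wX · φ)  u         = false
holds (F · φ)   u         = false
holds (G · φ)   u         = false

-- The automaton state: one bit per subformula occurrence, the formula's own bit last. This order
-- mirrors `size`, so the lengths agree definitionally.
profile : (α : Formula k) → Prefix k → Vec Bool (size α)
profile α@(atom p)  u = [ holds α u ]ᵥ
profile α@(¬atom p) u = [ holds α u ]ᵥ
profile α@(φ ∨ ψ)   u = (profile φ u ++ᵥ profile ψ u) ++ᵥ [ holds α u ]ᵥ
profile α@(φ ∧ ψ)   u = (profile φ u ++ᵥ profile ψ u) ++ᵥ [ holds α u ]ᵥ
profile α@(o · φ)   u = profile φ u ++ᵥ [ holds α u ]ᵥ

++[]-injective : ∀ {m} {A : Set} (xs ys : Vec A m) {x y : A} →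
                 xs ++ᵥ [ x ]ᵥ ≡ ys ++ᵥ [ y ]ᵥ → xs ≡ ys × x ≡ y
++[]-injective xs ys eq with eq₁ , eq₂ ← ++-injective xs ys eq = eq₁ , ∷-injectiveˡ eq₂

profile⇒holds : ∀ (α : Formula k) u v → profile α u ≡ profile α v → holds α u ≡ holds α v
profile⇒holds (atom p)  u v eq = ∷-injectiveˡ eq
profile⇒holds (¬atom p) u v eq = ∷-injectiveˡ eq
profile⇒holds (φ ∨ ψ)   u v eq = proj₂ (++[]-injective (profile φ u ++ᵥ profile ψ u) _ eq)
profile⇒holds (φ ∧ ψ)   u v eq = proj₂ (++[]-injective (profile φ u ++ᵥ profile ψ u) _ eq)
profile⇒holds (o · φ)   u v eq = proj₂ (++[]-injective (profile φ u) _ eq)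

-- Literals see only `b`; `Y` and `wY` read the old bit of their argument; `O` and `H` combine the
-- new value of the argument, known by induction, with their own old bit. One step is enough,
-- because a single letter is appended after profiles are compared.
holds-▷ : ∀ (α : Formula k) u v b → profile α u ≡ profile α v → holds α (u ▷ b) ≡ holds α (v ▷ b)
holds-▷ (atom p)  u v b eq = refl
holds-▷ (¬atom p) u v b eq = refl
holds-▷ (φ ∨ ψ)   u v b eq
  with eqφ , eqψ ← ++-injective (profile φ u) _ (proj₁ (++[]-injective (profile φ u ++ᵥ profile ψ u) _ eq))
  = cong₂ _||_ (holds-▷ φ u v b eqφ) (holds-▷ ψ u v b eqψ)
holds-▷ (φ ∧ ψ)   u v b eq
  with eqφ , eqψ ← ++-injective (profile φ u) _ (proj₁ (++[]-injective (profile φ u ++ᵥ profile ψ u) _ eq))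
  = cong₂ _&&_ (holds-▷ φ u v b eqφ) (holds-▷ ψ u v b eqψ)
holds-▷ (o · φ) u v b eq with eqφ , eqo ← ++[]-injective (profile φ u) _ eq = step o eqo
  where
  step : ∀ o → holds (o · φ) u ≡ holds (o · φ) v → holds (o · φ) (u ▷ b) ≡ holds (o · φ) (v ▷ b)
  step Y  _   = profile⇒holds φ u v eqφ
  step wY _   = profile⇒holds φ u v eqφ
  step O  eqo = cong₂ _||_ (holds-▷ φ u v b eqφ) eqo
  step H  eqo = cong₂ _&&_ (holds-▷ φ u v b eqφ) eqo
  step X  _   = refl
  step wX _   = refl
  step F  _   = refl
  step G  _   = refl

-- Prefixes of a trace and the semantics of past operators.

advance : Prefix k → (xs : List (Subset k)) → Fin (suc (length xs)) → Prefix k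
advance u xs       zero    = u
advance u (x ∷ xs) (suc i) = advance (u ▷ x) xs i

prefix : (σ : Trace k) → Position σ → Prefix k
prefix (a ∷ xs) = advance (start a) xs

last-advance : ∀ (u : Prefix k) xs i → last (advance u xs i) ≡ lookup (last u ∷ xs) i
last-advance u xs       zero    = refl
last-advance u (x ∷ xs) (suc i) = last-advance (u ▷ x) xs i

-- Exposes the newest letter, so that `holds` at `suc i` unfolds, with `inject₁ i` as the previous
-- position.
advance-suc : ∀ (u : Prefix k) xs i → advance u xs (suc i) ≡ advance u xs (inject₁ i) ▷ lookup xs i
advance-suc u (x ∷ xs) zero    = refl
advance-suc u (x ∷ xs) (suc i) = advance-suc (u ▷ x) xs i

-- Induction on the formula. The semantics of `O` and `H` quantifies over all earlier positions
-- while `holds` recurses along the prefix, so these cases carry an inner induction on the position.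
⊨⇔holds : ∀ (α : Formula k) → α ∈ LTL[ PastOps ] →
          ∀ σ i → (σ , i ⊨ α) ⇔ T (holds α (prefix σ i))
⊨⇔holds (atom p) _ (a ∷ xs) i rewrite last-advance (start a) xs i =
  mk⇔ (from T-≡ ∘ []=⇒lookup) (lookup⇒[]= p _ ∘ to T-≡)
⊨⇔holds (¬atom p) _ (a ∷ xs) i rewrite last-advance (start a) xs i =
  mk⇔ (λ p∉ → from T-not-≡ (¬-not (p∉ ∘ lookup⇒[]= p _)))
      (λ t p∈ → contradiction (trans (sym ([]=⇒lookup p∈)) (to T-not-≡ t)) λ ())
⊨⇔holds (φ ∨ ψ) (pφ , pψ) σ i = mk⇔
  (λ { (inj₁ h) → from T-∨ (inj₁ (to (⊨⇔holds φ pφ σ i) h))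
     ; (inj₂ h) → from T-∨ (inj₂ (to (⊨⇔holds ψ pψ σ i) h)) })
  (λ t → Sum.map (from (⊨⇔holds φ pφ σ i)) (from (⊨⇔holds ψ pψ σ i)) (to T-∨ t))
⊨⇔holds (φ ∧ ψ) (pφ , pψ) σ i = mk⇔
  (λ (h₁ , h₂) → from T-∧ (to (⊨⇔holds φ pφ σ i) h₁ , to (⊨⇔holds ψ pψ σ i) h₂))
  (λ t → Product.map (from (⊨⇔holds φ pφ σ i)) (from (⊨⇔holds ψ pψ σ i)) (to T-∧ t))
⊨⇔holds (Y · φ) (inj₁ refl , p) (a ∷ xs) zero = mk⇔ (λ { (_ , () , _) }) (λ ())
⊨⇔holds (Y · φ) (inj₁ refl , p) σ@(a ∷ xs) (suc i) rewrite advance-suc (start a) xs i = mk⇔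
  (λ (j , eq , h) → to ih (subst (σ ,_⊨ φ) (toℕ-injective (trans (suc-injective eq) (sym (toℕ-inject₁ i)))) h))
  (λ t → inject₁ i , cong suc (toℕ-inject₁ i) , from ih t)
  where ih = ⊨⇔holds φ p σ (inject₁ i)
⊨⇔holds (wY · φ) (inj₂ (inj₁ refl) , p) (a ∷ xs) zero = mk⇔ _ (λ _ → inj₁ refl)
⊨⇔holds (wY · φ) (inj₂ (inj₁ refl) , p) σ@(a ∷ xs) (suc i) rewrite advance-suc (start a) xs i = mk⇔
  (λ { (inj₁ ())
     ; (inj₂ (j , eq , h)) →
         to ih (subst (σ ,_⊨ φ) (toℕ-injective (trans (suc-injective eq) (sym (toℕ-inject₁ i)))) h) })
  (λ t → inj₂ (inject₁ i , cong suc (toℕ-inject₁ i) , from ih t))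
  where ih = ⊨⇔holds φ p σ (inject₁ i)
⊨⇔holds (O · φ) (inj₂ (inj₂ (inj₁ refl)) , p) σ@(a ∷ xs) = <-weakInduction P base step
  where
  P : Position σ → Set
  P i = (σ , i ⊨ O · φ) ⇔ T (holds (O · φ) (prefix σ i))

  base : P zero
  base = mk⇔ (λ { (zero , _ , h) → to (⊨⇔holds φ p σ zero) h })
             (λ t → zero , z≤n , from (⊨⇔holds φ p σ zero) t)

  step : ∀ i → P (inject₁ i) → P (suc i)
  -- The equivalence for `φ` at `suc i` is named before the rewrite, so that the rewrite reshapes
  -- its prefix as well.
  step i ih with ⊨⇔holds φ p σ (suc i)
  ... | now rewrite advance-suc (start a) xs i = mk⇔
    (λ (j , j≤ , h) → from T-∨ (split j j≤ h))
    (λ t → join (to T-∨ t))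
    where
    split : ∀ j → toℕ j ≤ suc (toℕ i) → σ , j ⊨ φ → _ ⊎ _
    split j j≤ h with m≤n⇒m<n∨m≡n j≤
    ... | inj₁ (s≤s j≤i) = inj₂ (to ih (j , subst (toℕ j ≤_) (sym (toℕ-inject₁ i)) j≤i , h))
    ... | inj₂ j≡        = inj₁ (to now (subst (σ ,_⊨ φ) (toℕ-injective j≡) h))
    join : _ ⊎ _ → σ , suc i ⊨ O · φ
    join (inj₁ t) = suc i , ≤-refl , from now t
    join (inj₂ t) with j , j≤ , h ← from ih t =
      j , ≤-trans j≤ (≤-trans (≤-reflexive (toℕ-inject₁ i)) (n≤1+n _)) , h
⊨⇔holds (H · φ) (inj₂ (inj₂ (inj₂ refl)) , p) σ@(a ∷ xs) = <-weakInduction P base step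
  where
  P : Position σ → Set
  P i = (σ , i ⊨ H · φ) ⇔ T (holds (H · φ) (prefix σ i))

  base : P zero
  base = mk⇔ (λ h → to (⊨⇔holds φ p σ zero) (h zero z≤n))
             (λ { t zero _ → from (⊨⇔holds φ p σ zero) t })

  step : ∀ i → P (inject₁ i) → P (suc i)
  step i ih with ⊨⇔holds φ p σ (suc i)
  ... | now rewrite advance-suc (start a) xs i = mk⇔
    (λ h → from T-∧ ( to now (h (suc i) ≤-refl)
                    , to ih (λ j j≤ → h j (≤-trans j≤ (≤-trans (≤-reflexive (toℕ-inject₁ i)) (n≤1+n _))))))
    (λ t j j≤ → join (to T-∧ t) j (m≤n⇒m<n∨m≡n j≤))
    where
    join : _ × _ → ∀ j → _ ⊎ _ → σ , j ⊨ φ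
    join (_ , t) j (inj₁ (s≤s j≤i)) = from ih t j (subst (toℕ j ≤_) (sym (toℕ-inject₁ i)) j≤i)
    join (t , _) j (inj₂ j≡)        = subst (σ ,_⊨ φ) (sym (toℕ-injective j≡)) (from now t)

-- Appending one letter.

advance-∷ʳ : ∀ (u : Prefix k) xs b i →
             (∃[ j ] advance u (xs ∷ʳ b) i ≡ advance u xs j) ⊎
             advance u (xs ∷ʳ b) i ≡ foldl _▷_ u xs ▷ b
advance-∷ʳ u []       b zero       = inj₁ (zero , refl)
advance-∷ʳ u []       b (suc zero) = inj₂ refl
advance-∷ʳ u (x ∷ xs) b zero       = inj₁ (zero , refl)
advance-∷ʳ u (x ∷ xs) b (suc i) with advance-∷ʳ (u ▷ x) xs b i
... | inj₁ (j , eq) = inj₁ (suc j , eq)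
... | inj₂ eq       = inj₂ eq

-- Maximality later places the query after every data letter.
final-position : ∀ (u : Prefix k) xs b →
                 ∃[ j ] (advance u (xs ∷ʳ b) j ≡ foldl _▷_ u xs ▷ b ×
                         (∀ (i : Fin (suc (length (xs ∷ʳ b)))) → toℕ i ≤ toℕ j))
final-position u []       b = suc zero , refl , λ { zero → z≤n ; (suc zero) → ≤-refl }
final-position u (x ∷ xs) b with j , eq , max ← final-position (u ▷ x) xs b =
  suc j , eq , λ { zero → z≤n ; (suc i) → s≤s (max i) }

-- As no position of `a ∷ xs` satisfies `α`, membership after appending `b` is owed to the last
-- position, where the value of `α` is determined by the profile and `b`. The negative hypothesis
-- rules out an earlier witness, which the profile need not record.
F-past-resp-profile : ∀ (α : Formula k) → α ∈ LTL[ PastOps ] → ∀ a xs ys b →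
                      profile α (foldl _▷_ (start a) xs) ≡ profile α (foldl _▷_ (start a) ys) →
                      ¬ (a ∷ xs) ∈ 𝓛 (F · α) →
                      (a ∷ (xs ∷ʳ b)) ∈ 𝓛 (F · α) → (a ∷ (ys ∷ʳ b)) ∈ 𝓛 (F · α)
F-past-resp-profile α past a xs ys b eq ¬xs (i , _ , h)
  with to (⊨⇔holds α past (a ∷ (xs ∷ʳ b)) i) h | advance-∷ʳ (start a) xs b i
... | t | inj₁ (j , eqⱼ) =
  contradiction (j , z≤n , from (⊨⇔holds α past (a ∷ xs) j) (subst (T ∘ holds α) eqⱼ t)) ¬xs
... | t | inj₂ eqᵢ with j , eqⱼ , _ ← final-position (start a) ys b =
  j , z≤n , from (⊨⇔holds α past (a ∷ (ys ∷ʳ b)) j)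
    (subst (T ∘ holds α) (sym eqⱼ)
      (subst T (holds-▷ α _ _ b eq) (subst (T ∘ holds α) eqᵢ t)))

-- Counting Boolean vectors, and families of words.

encode : Vec Bool n → Fin (2 ^ n)
encode []       = zero
encode (b ∷ bs) = combine (Inverse.from 2↔Bool b) (encode bs)

decode : Fin (2 ^ n) → Vec Bool n
decode {zero}  _ = []
decode {suc n} i = Inverse.to 2↔Bool (quotient {2} (2 ^ n) i) ∷ decode (remainder {2} (2 ^ n) i)

decode-encode : (v : Vec Bool n) → decode (encode v) ≡ v
decode-encode []       = refl
decode-encode (b ∷ bs) = cong₂ _∷_
  (trans (cong (Inverse.to 2↔Bool ∘ proj₁) split) (Inverse.strictlyInverseˡ 2↔Bool b))
  (trans (cong (decode ∘ proj₂) split) (decode-encode bs))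
  where split = remQuot-combine (Inverse.from 2↔Bool b) (encode bs)

encode-decode : (i : Fin (2 ^ n)) → encode (decode {n} i) ≡ i
encode-decode {zero}  zero = refl
encode-decode {suc n} i    = trans
  (cong₂ combine (Inverse.strictlyInverseʳ 2↔Bool (quotient {2} (2 ^ n) i))
                 (encode-decode {n} (remainder {2} (2 ^ n) i)))
  (combine-remQuot {2} (2 ^ n) i)

-- Pigeonhole: carried over to `Fin`, the injection gives `2 ^ m ≤ 2 ^ n`, which fails when `n < m`.
Vec-injective⇒≤ : ∀ {m} {f : Vec Bool m → Vec Bool n} → Injective _≡_ _≡_ f → m ≤ n
Vec-injective⇒≤ {n} {m} {f} inj with m ≤? n
... | yes m≤n = m≤n
... | no  m≰n = contradiction (injective⇒≤ {f = encode ∘ f ∘ decode {m}} g-inj)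
                              (<⇒≱ (^-monoʳ-< 2 ≤-refl (≰⇒> m≰n)))
  where
  g-inj : Injective _≡_ _≡_ (encode ∘ f ∘ decode {m})
  g-inj {i} {j} eq = trans (sym (encode-decode {m} i)) (trans (cong encode (inj
    (trans (sym (decode-encode _)) (trans (cong decode eq) (decode-encode _))))) (encode-decode {m} j))

lookup-ext : ∀ {A : Set} (u v : Vec A n) → (∀ i → lookupᵥ u i ≡ lookupᵥ v i) → u ≡ v
lookup-ext u v eq = trans (sym (tabulate∘lookup u)) (trans (tabulate-cong eq) (tabulate∘lookup v))

-- A set of n-bit words, given by its characteristic vector.
Family : ℕ → Set
Family n = Vec Bool (2 ^ n)

elements : Family n → List (Subset n)
elements {n} S = filter (λ w → T? (lookupᵥ S (encode w))) (map decode (allFin (2 ^ n)))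

∈-elements : ∀ (S : Family n) w → w ∈ˡ elements S ⇔ T (lookupᵥ S (encode w))
∈-elements {n} S w = mk⇔
  (λ w∈ → proj₂ (∈-filter⁻ member? {xs = words} w∈))
  (λ t → ∈-filter⁺ member? (subst (_∈ˡ words) (decode-encode w) (∈-map⁺ decode (∈-allFin (encode w)))) t)
  where
  member? : (w : Subset n) → Dec (T (lookupᵥ S (encode w)))
  member? w = T? (lookupᵥ S (encode w))
  words : List (Subset n)
  words = map decode (allFin (2 ^ n))

-- The succinct formula and its size.

literal : Bool → Fin k → Formula k
literal true  = atom
literal false = ¬atom

⊨literal : ∀ b (p : Fin k) σ i → (σ , i ⊨ literal b p) ⇔ lookupᵥ (σ [ i ]) p ≡ b
⊨literal true  p σ i = mk⇔ []=⇒lookup (lookup⇒[]= p _)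
⊨literal false p σ i = mk⇔ (λ p∉ → ¬-not (p∉ ∘ lookup⇒[]= p _))
  (λ eq p∈ → contradiction (trans (sym ([]=⇒lookup p∈)) eq) (λ ()))

-- Proposition zero marks query letters; the others carry the bits of a word.
recurs : Bool → Fin n → Formula (suc n)
recurs b i = literal b (suc i) ∧ F · (atom zero ∧ literal b (suc i))

-- Equality of bits at two positions is expressed by trying both values. Each bit gets its own `F`,
-- which keeps the conjunction over all bits linear in size.
queried : Fin n → Formula (suc n)
queried i = recurs true i ∨ recurs false i

⊨queried : ∀ (p : Fin n) σ i → (σ , i ⊨ queried p) ⇔
  (∃[ j ] (toℕ i ≤ toℕ j × zero ∈ₛ σ [ j ] × lookupᵥ (σ [ i ]) (suc p) ≡ lookupᵥ (σ [ j ]) (suc p)))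
⊨queried p σ i = mk⇔ (λ { (inj₁ h) → fwd true h ; (inj₂ h) → fwd false h })
                     (λ h → bwd _ refl h)
  where
  Agrees = ∃[ j ] (toℕ i ≤ toℕ j × zero ∈ₛ σ [ j ] × lookupᵥ (σ [ i ]) (suc p) ≡ lookupᵥ (σ [ j ]) (suc p))

  fwd : ∀ b → σ , i ⊨ recurs b p → Agrees
  fwd b (h , j , i≤j , q , h′) =
    j , i≤j , q , trans (to (⊨literal b (suc p) σ i) h) (sym (to (⊨literal b (suc p) σ j) h′))

  recur : ∀ b → lookupᵥ (σ [ i ]) (suc p) ≡ b → Agrees → σ , i ⊨ recurs b p
  recur b eq (j , i≤j , q , eq′) =
    from (⊨literal b (suc p) σ i) eq , j , i≤j , q , from (⊨literal b (suc p) σ j) (trans (sym eq′) eq)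

  bwd : ∀ b → lookupᵥ (σ [ i ]) (suc p) ≡ b → Agrees → σ , i ⊨ queried p
  bwd true  eq h = inj₁ (recur true eq h)
  bwd false eq h = inj₂ (recur false eq h)

-- The syntax has no constant for truth, so a given conjunct `χ` ends the chain.
conj : ∀ {m} → Formula k → (Fin m → Formula k) → Formula k
conj {m = zero}  χ f = χ
conj {m = suc m} χ f = f zero ∧ conj χ (f ∘ suc)

⊨conj : ∀ {m} χ (f : Fin m → Formula k) σ i →
        (σ , i ⊨ conj χ f) ⇔ ((σ , i ⊨ χ) × (∀ p → σ , i ⊨ f p))
⊨conj {m = zero}  χ f σ i = mk⇔ (λ h → h , λ ()) proj₁
⊨conj {m = suc m} χ f σ i = mk⇔
  (λ (h , hs) → let hχ , hf = to ih hs in hχ , λ { zero → h ; (suc p) → hf p })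
  (λ (hχ , hf) → hf zero , from ih (hχ , hf ∘ suc))
  where ih = ⊨conj χ (f ∘ suc) σ i

conj-LTL : ∀ {m S} χ (f : Fin m → Formula k) → χ ∈ LTL[ S ] → (∀ p → f p ∈ LTL[ S ]) → conj χ f ∈ LTL[ S ]
conj-LTL {m = zero}  χ f hχ hf = hχ
conj-LTL {m = suc m} χ f hχ hf = hf zero , conj-LTL χ (f ∘ suc) hχ (hf ∘ suc)

size-conj : ∀ {m} χ (f : Fin m → Formula k) s → (∀ p → size (f p) ≡ s) →
            size (conj χ f) ≡ size χ + m * (s + 1)
size-conj {m = zero}  χ f s eq = sym (+-identityʳ _)
size-conj {m = suc m} χ f s eq rewrite eq zero | size-conj χ (f ∘ suc) s (eq ∘ suc) =
  solve 3 (λ s c x → (s :+ (c :+ x)) :+ con 1 := c :+ ((s :+ con 1) :+ x)) refl s (size χ) (m * (s + 1))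
  where open +-*-Solver

-- Since `F` is reflexive, a query letter would match itself; `¬atom zero` forbids this.
matching : ∀ n → Formula (suc n)
matching n = F · conj {m = n} (¬atom zero) queried

-- Single queries as membership tests.

recording : List (Subset n) → List (Subset (suc n))
recording = map (outside ∷_)

-- The initial letter makes the prefix nonempty; being a query, it can neither be
-- matched nor match anything after it.
trace : List (Subset n) → List (Subset n) → Trace (suc n)
trace ws qs = (inside ∷ ∅) ∷ (recording ws ++ map (inside ∷_) qs)

-- The marker excludes the initial letter and the queries, so the witness is a data letter. The
-- agreeing query may vary with the bit `p`.
matching⇒∈ : ∀ (ws qs : List (Subset n)) → trace ws qs ∈ 𝓛 (matching n) →
             ∃[ w ] (w ∈ˡ ws × (∀ p → ∃[ q ] (q ∈ˡ qs × lookupᵥ w p ≡ lookupᵥ q p)))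
matching⇒∈ {n} ws qs (i , _ , h) with to (⊨conj (¬atom zero) queried (trace ws qs) i) h
matching⇒∈ {n} ws qs (zero , _ , h) | i∉ , _ = contradiction here i∉
matching⇒∈ {n} ws qs (suc i , _ , h) | i∉ , hs
  with ∈-++⁻ (recording ws) (∈-lookup {xs = recording ws ++ map (inside ∷_) qs} i)
... | inj₂ i∈ with _ , _ , eq ← ∈-map⁻ (inside ∷_) i∈ =
  contradiction (subst (zero ∈ₛ_) (sym eq) here) i∉
... | inj₁ i∈ with w , w∈ , eqw ← ∈-map⁻ (outside ∷_) i∈ = w , w∈ , matched
  where
  matched : ∀ p → ∃[ q ] (q ∈ˡ qs × lookupᵥ w p ≡ lookupᵥ q p)
  matched p with to (⊨queried p (trace ws qs) (suc i)) (hs p)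
  -- Position zero also carries a query, but it lies before `suc i`.
  ... | suc j , _ , j∈ , eq
    with ∈-++⁻ (recording ws) (∈-lookup {xs = recording ws ++ map (inside ∷_) qs} j)
  ... | inj₁ in-ws with _ , _ , eqj ← ∈-map⁻ (outside ∷_) in-ws
                   with () ← subst (zero ∈ₛ_) eqj j∈
  ... | inj₂ in-qs with q , q∈ , eqj ← ∈-map⁻ (inside ∷_) in-qs =
    q , q∈ , trans (cong (λ a → lookupᵥ a (suc p)) (sym eqw)) (trans eq (cong (λ a → lookupᵥ a (suc p)) eqj))

-- The final query repeats all bits of the data letter for `w`, so the last position serves every
-- `p` at once.
∈⇒matching : ∀ (ws : List (Subset n)) w → w ∈ˡ ws → trace ws (w ∷ []) ∈ 𝓛 (matching n)
∈⇒matching {n} ws w w∈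
  with j , eqj , max ← final-position (start (inside ∷ ∅)) (recording ws) (inside ∷ w) =
  suc i , z≤n , from (⊨conj (¬atom zero) queried σ (suc i))
    ( (λ i∈ → contradiction (subst (zero ∈ₛ_) (sym i-letter) i∈) λ ())
    , λ p → from (⊨queried p σ (suc i))
        ( j , max (suc i) , subst (zero ∈ₛ_) (sym j-letter) here
        , trans (cong (λ a → lookupᵥ a (suc p)) (sym i-letter)) (cong (λ a → lookupᵥ a (suc p)) (sym j-letter)) ) )
  where
  σ = trace ws (w ∷ [])
  w∈σ = ∈-++⁺ˡ {ys = (inside ∷ w) ∷ []} (∈-map⁺ (outside ∷_) w∈)
  i = index w∈σ
  i-letter : outside ∷ w ≡ σ [ suc i ]
  i-letter = lookup-index w∈σ
  j-letter : σ [ j ] ≡ inside ∷ w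
  j-letter = trans (sym (last-advance (start (inside ∷ ∅)) (recording ws ∷ʳ (inside ∷ w)) j)) (cong last eqj)

-- With only one query, the bitwise agreements all concern the same word, so they add up to
-- equality.
matching⇔∈ : ∀ (ws : List (Subset (suc n))) w → trace ws (w ∷ []) ∈ 𝓛 (matching (suc n)) ⇔ w ∈ˡ ws
matching⇔∈ ws w = mk⇔ fwd (∈⇒matching ws w)
  where
  fwd : trace ws (w ∷ []) ∈ 𝓛 (matching _) → w ∈ˡ ws
  fwd h with v , v∈ , agree ← matching⇒∈ ws (w ∷ []) h =
    subst (_∈ˡ ws) (lookup-ext v w (λ p → bit (agree p))) v∈
    where
    bit : ∀ {p} → ∃[ q ] (q ∈ˡ (w ∷ []) × lookupᵥ v p ≡ lookupᵥ q p) → lookupᵥ v p ≡ lookupᵥ w p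
    bit (_ , here refl , eq) = eq

-- Words have at least one bit, and its agreement would require a query; for words of length zero
-- the demand would be vacuous.
no-query : ∀ (ws : List (Subset (suc n))) → ¬ ((inside ∷ ∅) ∷ recording ws) ∈ 𝓛 (matching (suc n))
no-query {n} ws h
  with _ , _ , agree ← matching⇒∈ ws []
         (subst (λ xs → ((inside ∷ ∅) ∷ xs) ∈ 𝓛 (matching (suc n))) (sym (++-identityʳ (recording ws))) h)
  with _ , () , _ ← agree zero

-- The lower bound.

-- Sending a family to the profile after recording its elements is injective, and both ends are
-- spaces of Boolean vectors, so their dimensions compare.
matching-lower-bound : ∀ (α : Formula (suc (suc n))) → α ∈ LTL[ PastOps ] →
                       𝓛 (F · α) ≐ 𝓛 (matching (suc n)) → 2 ^ suc n ≤ size α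
matching-lower-bound {n} α past (⊆ , ⊇) = Vec-injective⇒≤ {f = λ S → profile α (reached S)} inj
  where
  reached : Family (suc n) → Prefix _
  reached S = foldl _▷_ (start (inside ∷ ∅)) (recording (elements S))

  -- The separating letter is the query for the word coded by `i`; swapping `S` and `S′` gives the
  -- converse.
  transfer : ∀ S S′ → profile α (reached S) ≡ profile α (reached S′) →
             ∀ i → lookupᵥ S i ≡ true → lookupᵥ S′ i ≡ true
  transfer S S′ eq i t = trans (cong (lookupᵥ S′) (sym ei)) (to T-≡ (to (∈-elements S′ w)
    (to (matching⇔∈ (elements S′) w) (⊆ (F-past-resp-profile α past _ _ _ _ eq
      (no-query (elements S) ∘ ⊆)
      (⊇ (from (matching⇔∈ (elements S) w)
        (from (∈-elements S w) (from T-≡ (trans (cong (lookupᵥ S) ei) t))))))))))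
    where
    w = decode {suc n} i
    ei = encode-decode {suc n} i

  inj : Injective _≡_ _≡_ (λ S → profile α (reached S))
  inj {S} {S′} eq = lookup-ext S S′ λ i →
    ⇔→≡ (mk⇔ (transfer S S′ eq i) (transfer S′ S (sym eq) i))

theorem2 : Σ[ AP ∈ (ℕ → ℕ) ] Σ[ L ∈ ((n : ℕ) → Language (AP n)) ]
    Σ[ p ∈ Polynomial ] Σ[ g ∈ (ℕ → ℕ) ]
    (g ∈ 2^Ω[n] ×
    ((n : ℕ) → 1 ≤ n →
    (Σ[ φ ∈ Formula (AP n) ] (φ ∈ LTL[ OnlyF ] × 𝓛 φ ≐ L n × size φ ≤ eval p n)) ×
    ((ψ : Formula (AP n)) → ψ ∈ F⟨LTL[ PastOps ]⟩ → 𝓛 ψ ≐ L n → g n ≤ size ψ)))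
-- The polynomial is 2 + 14n: each bit costs 13 for `queried` and 1 for its conjunction, while
-- `¬atom zero` and the outer `F` add 2.
theorem2 = suc , (λ n → 𝓛 (matching n)) , 2 ∷ 14 ∷ [] , (2 ^_) ,
  (1 , 1 , 0 , ≤-refl , ≤-refl , λ n _ → ≤-reflexive (trans (cong (2 ^_) (*-identityˡ n)) (sym (*-identityʳ _)))) ,
  λ { (suc n) _ →
    ( matching (suc n)
    , (refl , conj-LTL {m = suc n} {S = OnlyF} (¬atom zero) queried tt (λ _ → (tt , refl , tt , tt) , (tt , refl , tt , tt)))
    , (id , id)
    , ≤-reflexive (size-matching (suc n)))
    , λ { _ (α , past , refl) eq → ≤-trans (matching-lower-bound α past eq) (m≤m+n _ 1) } }
  where
  size-matching : ∀ n → size (matching n) ≡ 2 + n * (14 + n * 0)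
  size-matching n rewrite size-conj {m = n} (¬atom zero) queried 13 (λ _ → refl) | *-zeroʳ n =
    +-comm (1 + n * 14) 1
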